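{- The system $\mathbf{KB}^\blacktriangle$ is sound and strongly complete with respect to the class of symmetric frames ($\mathcal{B}$-frames); thus it is also sound and strongly complete with respect to the class of reflexive and symmetric frames ($\mathcal{TB}$-frames).
   Context: Let $\mathbf{P}$ be a set of propositional variables. $\mathcal{L}(\blacktriangle)$-formulas: $\varphi::=\top\mid p\mid\neg\varphi\mid(\varphi\land\varphi)\mid\blacktriangle\varphi$ with $p\in\mathbf{P}$; other Boolean connectives are defined as usual. A frame is $\langle S,R\rangle$ with $S$ nonempty and $R\subseteq S\times S$; a model on it adds a valuation $V:\mathbf{P}\to\mathcal{P}(S)$. Truth: $\top$, variables, $\neg$, $\land$ as usual; $\mathcal{M},s\vDash\blacktriangle\varphi$ iff (if $\mathcal{M},s\vDash\varphi$ then $\mathcal{M},t\vDash\varphi$ for all $t$ with $sRt$) and (if $\mathcal{M},s\nvDash\varphi$ then $\mathcal{M},t\nvDash\varphi$ for all $t$ with $sRt$). $\Gamma$ entails $\varphi$ over a class of frames if $\Gamma\cup\{\neg\varphi\}$ is not satisfied at any point of any model based on a frame in the class. The axiomatic system $\mathbf{K}^\blacktriangle$ consists of all propositional tautologies, uniform substitution, modus ponens, plus the axioms (with $p,q$ propositional variables) $\blacktriangle\top$; $\ \blacktriangle\neg p\leftrightarrow\blacktriangle p$; $\ \blacktriangle p\land\blacktriangle q\to\blacktriangle(p\land q)$; and the inference rule R: from $\varphi\to\psi$ infer $\blacktriangle\varphi\land\varphi\to\blacktriangle\psi$. $\mathbf{KB}^\blacktriangle$ is $\mathbf{K}^\blacktriangle$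 plus the axiom $p\to\blacktriangle(\blacktriangle p\to p)$. A derivation from $\Gamma$ to $\varphi$ in the system, notation $\Gamma\vdash\varphi$, is a finite sequence of $\mathcal{L}(\blacktriangle)$-formulas (ending in $\varphi$) in which each formula is either an instantiation of an axiom, or an element of $\Gamma$, or the result of applying an inference rule to prior formulas in the sequence. A theorem is a formula derivable from the empty set. Sound with respect to a class of frames: every theorem is valid on every frame of the class. Strongly complete with respect to a class: for all $\Gamma\cup\{\varphi\}\subseteq\mathcal{L}(\blacktriangle)$, if $\Gamma$ entails $\varphi$ over the class then $\Gamma\vdash\varphi$. -}

module Defs where

open import Level using (Level; 0ℓ; suc)
open import Data.Bool.Base as Bool using (Bool; true)
open import Data.List.Base using (List; []; _∷_)
import Data.List.Membership.Propositional as List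
open import Data.Nat.Base using (ℕ)
open import Data.Product.Base using (∃; _×_)
import Data.Unit.Polymorphic.Base as Unit
open import Induction.WellFounded using (WellFounded)
open import Relation.Binary.Core using (Rel)
open import Relation.Binary.Definitions using (Reflexive; Symmetric)
open import Relation.Binary.PropositionalEquality.Core using (_≡_)
open import Relation.Binary.Structures using (IsStrictTotalOrder)
open import Relation.Nullary.Negation.Core using (¬_)
open import Relation.Unary using (Pred; _∈_; _∪_; ｛_｝)
open import Relation.Unary.Polymorphic using (∅)

private
  variable
    ℓ q : Level
    P Q : Set ℓ

-- The axiom of choice in the form of Zermelo's well-ordering theorem.
-- Together with excluded middle it makes explicit the classical metatheory
-- (ZFC) in which completeness for an arbitrary set of variables is proved.
WellOrdering : ∀ ℓ → Set (suc ℓ)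
WellOrdering ℓ =
  (A : Set ℓ) → ∃ λ (_<_ : Rel A ℓ) → IsStrictTotalOrder _≡_ _<_ × WellFounded _<_

infix  9 ▲_ ∼_
infixr 7 _∧_
infixr 5 _⇒_
infix  4 _⇔_

data Formula (P : Set ℓ) : Set ℓ where
  ⊤   : Formula P
  var : P → Formula P
  ∼_  : Formula P → Formula P
  _∧_ : Formula P → Formula P → Formula P
  ▲_  : Formula P → Formula P

_⇒_ _⇔_ : Formula P → Formula P → Formula P
φ ⇒ ψ = ∼ (φ ∧ ∼ ψ)
φ ⇔ ψ = (φ ⇒ ψ) ∧ (ψ ⇒ φ)

infix 10 _[_]

_[_] : Formula Q → (Q → Formula P) → Formula P
⊤       [ σ ] = ⊤
var x   [ σ ] = σ x
(∼ φ)   [ σ ] = ∼ (φ [ σ ])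
(φ ∧ ψ) [ σ ] = φ [ σ ] ∧ ψ [ σ ]
(▲ φ)   [ σ ] = ▲ (φ [ σ ])

record Frame (ℓ : Level) : Set (suc ℓ) where
  field
    S        : Set ℓ
    nonempty : S
    R        : Rel S ℓ

record Model (P : Set ℓ) : Set (suc ℓ) where
  field
    frame : Frame ℓ
  open Frame frame public
  field
    V : P → Pred S ℓ

infix 3 _,_⊨_

_,_⊨_ : {P : Set ℓ} (M : Model P) → Model.S M → Formula P → Set ℓ
M , s ⊨ ⊤     = Unit.⊤
M , s ⊨ var p = s ∈ Model.V M p
M , s ⊨ ∼ φ   = ¬ (M , s ⊨ φ)
M , s ⊨ φ ∧ ψ = (M , s ⊨ φ) × (M , s ⊨ ψ)
M , s ⊨ ▲ φ   =
  ((M , s ⊨ φ) → ∀ t → Model.R M s t → M , t ⊨ φ) ×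
  (¬ (M , s ⊨ φ) → ∀ t → Model.R M s t → ¬ (M , t ⊨ φ))

FrameClass : ∀ ℓ → Set (suc ℓ)
FrameClass ℓ = Pred (Frame ℓ) ℓ

ℬ-frames 𝒯ℬ-frames : FrameClass ℓ
ℬ-frames  F = Symmetric (Frame.R F)
𝒯ℬ-frames F = Reflexive (Frame.R F) × Symmetric (Frame.R F)

Valid : {P : Set ℓ} → Frame ℓ → Formula P → Set (suc ℓ)
Valid {P = P} F φ =
  (V : P → Pred (Frame.S F) _) (s : Frame.S F) → record { frame = F ; V = V } , s ⊨ φ

SatisfiedAt : {P : Set ℓ} (M : Model P) → Model.S M → Pred (Formula P) ℓ → Set ℓ
SatisfiedAt M s Γ = ∀ φ → φ ∈ Γ → M , s ⊨ φ

Entails : {P : Set ℓ} → FrameClass ℓ → Pred (Formula P) ℓ → Formula P → Set (suc ℓ)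
Entails {P = P} C Γ φ =
  (M : Model P) → Model.frame M ∈ C → (s : Model.S M) → ¬ SatisfiedAt M s (Γ ∪ ｛ ∼ φ ｝)

data Propositional {Q : Set q} : Formula Q → Set q where
  ⊤   : Propositional ⊤
  var : ∀ x → Propositional (var x)
  ∼_  : ∀ {φ} → Propositional φ → Propositional (∼ φ)
  _∧_ : ∀ {φ ψ} → Propositional φ → Propositional ψ → Propositional (φ ∧ ψ)

eval : {Q : Set q} {φ : Formula Q} → Propositional φ → (Q → Bool) → Bool
eval ⊤       v = true
eval (var x) v = v x
eval (∼ a)   v = Bool.not (eval a v)
eval (a ∧ b) v = eval a v Bool.∧ eval b v

Tautology : {Q : Set q} → Pred (Formula Q) q
Tautology φ = ∃ λ (a : Propositional φ) → ∀ v → eval a v ≡ true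

-- Axioms are written with schematic variables indexed by ℕ, so that there are
-- always enough of them, however few variables P has. Uniform substitution
-- enters by instantiating them with arbitrary formulas over P.
AxiomSet : Set₁
AxiomSet = Pred (Formula ℕ) 0ℓ

private
  p₀ p₁ : Formula ℕ
  p₀ = var 0
  p₁ = var 1

data 𝐊▲ : AxiomSet where
  taut : ∀ {φ} → Tautology φ → 𝐊▲ φ
  ▲⊤   : 𝐊▲ (▲ ⊤)
  ▲∼   : 𝐊▲ (▲ (∼ p₀) ⇔ ▲ p₀)
  ▲∧   : 𝐊▲ (▲ p₀ ∧ ▲ p₁ ⇒ ▲ (p₀ ∧ p₁))

𝐊𝐁▲ : AxiomSet
𝐊𝐁▲ = 𝐊▲ ∪ ｛ p₀ ⇒ ▲ (▲ p₀ ⇒ p₀) ｝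

data Justified {P : Set ℓ} (Ax : AxiomSet) (Γ : Pred (Formula P) ℓ)
               (prior : List (Formula P)) : Formula P → Set ℓ where
  axiom   : ∀ {α} → α ∈ Ax → (σ : ℕ → Formula P) → Justified Ax Γ prior (α [ σ ])
  premise : ∀ {φ} → φ ∈ Γ → Justified Ax Γ prior φ
  mp      : ∀ {φ ψ} → (φ ⇒ ψ) List.∈ prior → φ List.∈ prior → Justified Ax Γ prior ψ
  rule-R  : ∀ {φ ψ} → (φ ⇒ ψ) List.∈ prior → Justified Ax Γ prior (▲ φ ∧ φ ⇒ ▲ ψ)

-- The sequence is listed backwards: its last formula is the head of the list.
data Derivation {P : Set ℓ} (Ax : AxiomSet) (Γ : Pred (Formula P) ℓ) :
                List (Formula P) → Set ℓ where
  []  : Derivation Ax Γ []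
  _∷_ : ∀ {φ prior} → Justified Ax Γ prior φ → Derivation Ax Γ prior →
        Derivation Ax Γ (φ ∷ prior)

infix 3 _,_⊢_

_,_⊢_ : {P : Set ℓ} → AxiomSet → Pred (Formula P) ℓ → Formula P → Set ℓ
Ax , Γ ⊢ φ = ∃ λ prior → Derivation Ax Γ (φ ∷ prior)

Sound : Set ℓ → AxiomSet → FrameClass ℓ → Set (suc ℓ)
Sound P Ax C = (φ : Formula P) → Ax , ∅ ⊢ φ → ∀ F → F ∈ C → Valid F φ

StronglyComplete : Set ℓ → AxiomSet → FrameClass ℓ → Set (suc ℓ)
StronglyComplete P Ax C =
  (Γ : Pred (Formula P) _) (φ : Formula P) → Entails C Γ φ → Ax , Γ ⊢ φ

{-# OPTIONS --safe #-}
-- Soundness is by induction on derivations.  For completeness take the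
-- canonical model whose points are the maximal consistent sets, with s R t iff
-- ▲ φ , φ ∈ s implies φ ∈ t.  R is trivially reflexive.  It is also symmetric:
-- if s R t, ▲ φ , φ ∈ t and ∼ φ ∈ s, then ▲ ∼ φ ⇒ ∼ φ and, by the axiom
-- p ⇒ ▲ (▲ p ⇒ p), also ▲ (▲ ∼ φ ⇒ ∼ φ) are in s; hence ▲ ∼ φ ⇒ ∼ φ ∈ t, and
-- ▲ ∼ φ ∈ t because ▲ φ ∈ t, so ∼ φ ∈ t, a contradiction.  Thus the canonical
-- frame is a 𝒯ℬ-frame, which settles both classes at once.
module Submission where

open import Level using (Level; Lift; lift; lower; 0ℓ; _⊔_)
open import Axiom.ExcludedMiddle using (ExcludedMiddle)
open import Data.Bool.Base as Bool using (Bool; true; false; not; T)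
open import Data.Bool.Properties using (T-∧; T-≡)
open import Data.List.Base using (List; []; _∷_; _++_)
import Data.List.Membership.Propositional as List
open import Data.List.Membership.Propositional.Properties using (∈-++⁺ˡ; ∈-++⁺ʳ)
import Data.List.Relation.Binary.Subset.Propositional as List
open import Data.List.Relation.Unary.All as All using (All; []; _∷_)
open import Data.List.Relation.Unary.Any using (here)
open import Data.Nat.Base using (ℕ; suc)
open import Data.Product.Base using (∃; _×_; _,_; proj₁; proj₂)
open import Data.Sum.Base using (_⊎_; inj₁; inj₂)
open import Function.Base using (_∘_; id)
open import Function.Bundles using (Equivalence; mk⇔)
open import Induction.WellFounded using (WellFounded; module All; module FixPoint)
open import Relation.Binary.Core using (Rel)
open import Relation.Binary.Definitions
  using (Reflexive; Symmetric; tri<; tri≈; tri>)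
open import Relation.Binary.PropositionalEquality
  using (_≡_; refl; sym; trans; cong; cong₂; subst)
open import Relation.Binary.Structures using (IsStrictTotalOrder)
open import Relation.Nullary using (¬_; does; proof; contradiction)
open import Relation.Nullary.Decidable using (does-⇔; decidable-stable)
open import Relation.Nullary.Reflects
  using (Reflects; ofʸ; ofⁿ; ¬-reflects; _×-reflects_; fromEquivalence)
open import Relation.Unary using (Pred; _∈_; _⊆_; _∪_; ｛_｝)
open import Relation.Unary.Polymorphic using (∅)
open import Defs

private
  variable
    ℓ a b : Level
    P : Set ℓ
    φ ψ : Formula P

-- Derivations

weaken : {Ax : AxiomSet} {Γ Δ : Pred (Formula P) ℓ} {xs ys : List (Formula P)} →
         Γ ⊆ Δ → xs List.⊆ ys → Justified Ax Γ xs φ → Justified Ax Δ ys φ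
weaken Γ⊆Δ xs⊆ys (axiom α σ)   = axiom α σ
weaken Γ⊆Δ xs⊆ys (premise φ∈Γ) = premise (Γ⊆Δ φ∈Γ)
weaken Γ⊆Δ xs⊆ys (mp i j)      = mp (xs⊆ys i) (xs⊆ys j)
weaken Γ⊆Δ xs⊆ys (rule-R i)    = rule-R (xs⊆ys i)

derivation-mono : {Ax : AxiomSet} {Γ Δ : Pred (Formula P) ℓ} {xs : List (Formula P)} →
                  Γ ⊆ Δ → Derivation Ax Γ xs → Derivation Ax Δ xs
derivation-mono Γ⊆Δ []       = []
derivation-mono Γ⊆Δ (j ∷ ds) = weaken Γ⊆Δ id j ∷ derivation-mono Γ⊆Δ ds

derivation-++ : {Ax : AxiomSet} {Γ : Pred (Formula P) ℓ} {xs ys : List (Formula P)} →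
                Derivation Ax Γ xs → Derivation Ax Γ ys → Derivation Ax Γ (xs ++ ys)
derivation-++ []       es = es
derivation-++ (j ∷ ds) es = weaken id ∈-++⁺ˡ j ∷ derivation-++ ds es

⊢-mono : {Ax : AxiomSet} {Γ Δ : Pred (Formula P) ℓ} →
         Γ ⊆ Δ → Ax , Γ ⊢ φ → Ax , Δ ⊢ φ
⊢-mono Γ⊆Δ (_ , d) = _ , derivation-mono Γ⊆Δ d

⊢-axiom : {Ax : AxiomSet} {Γ : Pred (Formula P) ℓ} {α : Formula ℕ} →
          α ∈ Ax → (σ : ℕ → Formula P) → Ax , Γ ⊢ α [ σ ]
⊢-axiom α∈Ax σ = [] , axiom α∈Ax σ ∷ []

⊢-mp : {Ax : AxiomSet} {Γ : Pred (Formula P) ℓ} →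
       Ax , Γ ⊢ φ ⇒ ψ → Ax , Γ ⊢ φ → Ax , Γ ⊢ ψ
⊢-mp (xs , d) (_ , e) =
  _ , mp (here refl) (∈-++⁺ʳ (_ ∷ xs) (here refl)) ∷ derivation-++ d e

⊢-rule-R : {Ax : AxiomSet} {Γ : Pred (Formula P) ℓ} →
           Ax , Γ ⊢ φ ⇒ ψ → Ax , Γ ⊢ ▲ φ ∧ φ ⇒ ▲ ψ
⊢-rule-R (_ , d) = _ , rule-R (here refl) ∷ d

infix 3 ⊢_

⊢_ : {P : Set ℓ} → Formula P → Set ℓ
⊢ φ = 𝐊𝐁▲ , ∅ ⊢ φ

-- Tautologies

every : (Bool → Bool) → Bool
every f = f true Bool.∧ f false

every-sound : ∀ f → T (every f) → ∀ b → T (f b)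
every-sound f h true  = proj₁ (Equivalence.to T-∧ h)
every-sound f h false = proj₂ (Equivalence.to T-∧ h)

triple : {A : Set a} → A → A → A → ℕ → A
triple x y z 0             = x
triple x y z 1             = y
triple x y z (suc (suc _)) = z

truth-table : {α : Formula ℕ} → Propositional α → Bool
truth-table α = every λ x → every λ y → every λ z → eval α (triple x y z)

-- For a concrete α in which only the variables 0, 1 and 2 occur, the third
-- argument is refl and the fourth is found by evaluating the truth table.
tautology : {α : Formula ℕ} (a : Propositional α) (φ ψ χ : Formula P) →
            (∀ v → eval a v ≡ eval a (triple (v 0) (v 1) (v 2))) →
            T (truth-table a) → ⊢ α [ triple φ ψ χ ]
tautology a φ ψ χ three table = ⊢-axiom (inj₁ (taut (a , valid))) (triple φ ψ χ)
  where
  valid : ∀ v → eval a v ≡ true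
  valid v = trans (three v) (Equivalence.to T-≡
    (every-sound (λ z → eval a (triple (v 0) (v 1) z))
      (every-sound (λ y → every λ z → eval a (triple (v 0) y z))
        (every-sound (λ x → every λ y → every λ z → eval a (triple x y z)) table (v 0))
        (v 1))
      (v 2)))

infixr 5 _⟶_

_⟶_ : {α β : Formula ℕ} → Propositional α → Propositional β → Propositional (α ⇒ β)
a ⟶ b = ∼ (a ∧ ∼ b)

p₀ : Propositional (var 0)
p₀ = var 0

p₁ : Propositional (var 1)
p₁ = var 1

p₂ : Propositional (var 2)
p₂ = var 2

⊢-⊤ : {P : Set ℓ} → ⊢ ⊤ {P = P}
⊢-⊤ = tautology ⊤ ⊤ ⊤ ⊤ (λ _ → refl) _

⊢-id : (φ : Formula P) → ⊢ φ ⇒ φ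
⊢-id φ = tautology (p₀ ⟶ p₀) φ φ φ (λ _ → refl) _

⊢-K : (φ ψ : Formula P) → ⊢ φ ⇒ ψ ⇒ φ
⊢-K φ ψ = tautology (p₀ ⟶ p₁ ⟶ p₀) φ ψ ψ (λ _ → refl) _

⊢-S : (φ ψ χ : Formula P) → ⊢ (φ ⇒ ψ ⇒ χ) ⇒ (φ ⇒ ψ) ⇒ φ ⇒ χ
⊢-S φ ψ χ = tautology ((p₀ ⟶ p₁ ⟶ p₂) ⟶ (p₀ ⟶ p₁) ⟶ p₀ ⟶ p₂) φ ψ χ (λ _ → refl) _

⊢-pair : (φ ψ : Formula P) → ⊢ φ ⇒ ψ ⇒ φ ∧ ψ
⊢-pair φ ψ = tautology (p₀ ⟶ p₁ ⟶ p₀ ∧ p₁) φ ψ ψ (λ _ → refl) _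

⊢-fst : (φ ψ : Formula P) → ⊢ φ ∧ ψ ⇒ φ
⊢-fst φ ψ = tautology (p₀ ∧ p₁ ⟶ p₀) φ ψ ψ (λ _ → refl) _

⊢-snd : (φ ψ : Formula P) → ⊢ φ ∧ ψ ⇒ ψ
⊢-snd φ ψ = tautology (p₀ ∧ p₁ ⟶ p₁) φ ψ ψ (λ _ → refl) _

⊢-eval : (φ ψ : Formula P) → ⊢ (φ ⇒ ψ) ∧ φ ⇒ ψ
⊢-eval φ ψ = tautology ((p₀ ⟶ p₁) ∧ p₀ ⟶ p₁) φ ψ ψ (λ _ → refl) _

⊢-explosion : (φ : Formula P) → ⊢ φ ⇒ ∼ φ ⇒ ∼ ⊤
⊢-explosion φ = tautology (p₀ ⟶ ∼ p₀ ⟶ ∼ ⊤) φ φ φ (λ _ → refl) _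

⊢-negation : (φ : Formula P) → ⊢ (φ ⇒ ∼ ⊤) ⇒ ∼ φ
⊢-negation φ = tautology ((p₀ ⟶ ∼ ⊤) ⟶ ∼ p₀) φ φ φ (λ _ → refl) _

⊢-double-negation : (φ : Formula P) → ⊢ ∼ (∼ φ) ⇒ φ
⊢-double-negation φ = tautology (∼ (∼ p₀) ⟶ p₀) φ φ φ (λ _ → refl) _

⊢-▲∼ : (φ : Formula P) → ⊢ ▲ (∼ φ) ⇔ ▲ φ
⊢-▲∼ φ = ⊢-axiom (inj₁ ▲∼) (triple φ φ φ)

⊢-▲∧ : (φ ψ : Formula P) → ⊢ ▲ φ ∧ ▲ ψ ⇒ ▲ (φ ∧ ψ)
⊢-▲∧ φ ψ = ⊢-axiom (inj₁ ▲∧) (triple φ ψ ψ)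

⊢-▲B : (φ : Formula P) → ⊢ φ ⇒ ▲ (▲ φ ⇒ φ)
⊢-▲B φ = ⊢-axiom (inj₂ refl) (triple φ φ φ)

-- Rule R applied to ⊤ ⇒ φ; the axiom `▲ ⊤` discharges the antecedent.
⊢-▲-necessitation : ⊢ φ → ⊢ ▲ φ
⊢-▲-necessitation {φ = φ} d = ⊢-mp (⊢-rule-R (⊢-mp (⊢-K φ ⊤) d))
  (⊢-mp (⊢-mp (⊢-pair (▲ ⊤) ⊤) (⊢-axiom (inj₁ ▲⊤) (triple φ φ φ))) ⊢-⊤)

-- Local consequence

infix  3 _⊩_
infixl 9 _·_

-- Unlike in 𝐊𝐁▲ , A ⊢ φ, rule R is not applicable to the premises here.
data _⊩_ {P : Set ℓ} (A : Pred (Formula P) a) : Formula P → Set (ℓ ⊔ a) where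
  theorem : ⊢ φ → A ⊩ φ
  hyp     : φ ∈ A → A ⊩ φ
  _·_     : A ⊩ φ ⇒ ψ → A ⊩ φ → A ⊩ ψ

⊩-mono : {A : Pred (Formula P) a} {B : Pred (Formula P) b} → A ⊆ B → A ⊩ φ → B ⊩ φ
⊩-mono A⊆B (theorem d) = theorem d
⊩-mono A⊆B (hyp φ∈A)   = hyp (A⊆B φ∈A)
⊩-mono A⊆B (d · e)     = ⊩-mono A⊆B d · ⊩-mono A⊆B e

-- Completeness is proved for `_⊩_`; this carries it over to the more permissive `_,_⊢_`.
⊩⇒⊢ : {P : Set ℓ} {φ : Formula P} {Γ : Pred (Formula P) ℓ} → Γ ⊩ φ → 𝐊𝐁▲ , Γ ⊢ φ
⊩⇒⊢ (theorem d) = ⊢-mono (λ ()) d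
⊩⇒⊢ (hyp φ∈Γ)   = [] , premise φ∈Γ ∷ []
⊩⇒⊢ (d · e)     = ⊢-mp (⊩⇒⊢ d) (⊩⇒⊢ e)

-- Possible because `_⊩_` never applies rule R to a premise, so modus ponens is the only rule to be
-- lifted, by S.
deduction : {P : Set ℓ} {φ ψ : Formula P} {A : Pred (Formula P) a} → A ∪ ｛ φ ｝ ⊩ ψ → A ⊩ φ ⇒ ψ
deduction {φ = φ} (theorem d)            = theorem (⊢-mp (⊢-K _ φ) d)
deduction {φ = φ} (hyp (inj₁ ψ∈A))       = theorem (⊢-K _ φ) · hyp ψ∈A
deduction         (hyp (inj₂ refl))      = theorem (⊢-id _)
deduction         (d · e)                = theorem (⊢-S _ _ _) · deduction d · deduction e

-- Consistency and maximal consistent sets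

Consistent : {P : Set ℓ} → Pred (Formula P) a → Set (ℓ ⊔ a)
Consistent A = ¬ (A ⊩ ∼ ⊤)

consistent⇒¬both : {A : Pred (Formula P) a} → Consistent A → A ⊩ φ → A ⊩ ∼ φ →
                   ∀ {w} {W : Set w} → W
consistent⇒¬both con d e = contradiction (theorem (⊢-explosion _) · d · e) con

refute : {P : Set ℓ} {φ : Formula P} {A : Pred (Formula P) a} → A ∪ ｛ φ ｝ ⊩ ∼ ⊤ → A ⊩ ∼ φ
refute d = theorem (⊢-negation _) · deduction d

-- A set of formulas is Bool-valued, since a type of Set-valued predicates would
-- be too large to be the carrier of a frame.
Members : {P : Set ℓ} → (Formula P → Bool) → Pred (Formula P) 0ℓ
Members f φ = f φ ≡ true

-- A maximal consistent set: `closed` puts ⊤ in, so `complement` keeps ∼ ⊤ out, and by `closed` it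
-- is then not derivable.
record World (P : Set ℓ) : Set ℓ where
  field
    val        : Formula P → Bool
    closed     : Members val ⊩ φ → val φ ≡ true
    complement : (φ : Formula P) → val (∼ φ) ≡ not (val φ)

open World

infix 4 _∋_ _∌_

_∋_ : {P : Set ℓ} → World P → Formula P → Set
w ∋ φ = val w φ ≡ true

_∌_ : {P : Set ℓ} → World P → Formula P → Set
w ∌ φ = val w φ ≡ false

world-mp : (w : World P) → ⊢ φ ⇒ ψ → w ∋ φ → w ∋ ψ
world-mp w d φ∈w = closed w (theorem d · hyp φ∈w)

∼-∈ : (w : World P) → w ∌ φ → w ∋ ∼ φ
∼-∈ {φ = φ} w φ∉w = trans (complement w φ) (cong not φ∉w)

∼-∉ : (w : World P) → w ∋ φ → w ∌ ∼ φ
∼-∉ {φ = φ} w φ∈w = trans (complement w φ) (cong not φ∈w)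

val-⊤ : (w : World P) → w ∋ ⊤
val-⊤ w = closed w (theorem ⊢-⊤)

val-∧ : (w : World P) (φ ψ : Formula P) → val w (φ ∧ ψ) ≡ val w φ Bool.∧ val w ψ
val-∧ w φ ψ with val w (φ ∧ ψ) in e
... | true = sym (cong₂ Bool._∧_ (world-mp w (⊢-fst φ ψ) e) (world-mp w (⊢-snd φ ψ) e))
... | false with val w φ in e₁ | val w ψ in e₂
...   | false | _     = refl
...   | true  | false = refl
...   | true  | true  =
  trans (sym e) (closed w (theorem (⊢-pair φ ψ) · hyp e₁ · hyp e₂))

∋∼⇒¬∋ : (w : World P) → w ∋ ∼ φ → ¬ (w ∋ φ)
∋∼⇒¬∋ w ∼φ∈w φ∈w = contradiction (trans (sym ∼φ∈w) (∼-∉ w φ∈w)) λ ()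

▲∼-∈ : (w : World P) → w ∋ ▲ φ → w ∋ ▲ (∼ φ)
▲∼-∈ w = world-mp w (⊢-mp (⊢-snd _ _) (⊢-▲∼ _))

▲-∈ : (w : World P) → w ∋ ▲ (∼ φ) → w ∋ ▲ φ
▲-∈ w = world-mp w (⊢-mp (⊢-fst _ _) (⊢-▲∼ _))

-- Lindenbaum's lemma

module Lindenbaum {ℓ : Level} (em : ExcludedMiddle ℓ) {P : Set ℓ}
  (_<_ : Rel (Formula P) ℓ) (sto : IsStrictTotalOrder _≡_ _<_) (wf : WellFounded _<_)
  (Γ : Pred (Formula P) ℓ) (consistent : Consistent Γ) where

  open IsStrictTotalOrder sto using (compare) renaming (trans to <-trans)

  -- `b` stands for the choices already made below φ, so that the recursion step can be stated
  -- before `chosen` exists.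
  Stage : (φ : Formula P) → (∀ {ψ} → ψ < φ → Bool) → Pred (Formula P) ℓ
  Stage φ b = Γ ∪ (λ ψ → ∃ λ (ψ<φ : ψ < φ) → b ψ<φ ≡ true) ∪ ｛ φ ｝

  step : (φ : Formula P) → (∀ {ψ} → ψ < φ → Bool) → Bool
  step φ b = does (em {Consistent (Stage φ b)})

  Stage-mono : (φ : Formula P) {b c : ∀ {ψ} → ψ < φ → Bool} →
               (∀ {ψ} (ψ<φ : ψ < φ) → b ψ<φ ≡ c ψ<φ) → Stage φ b ⊆ Stage φ c
  Stage-mono φ b≡c (inj₁ ψ∈Γ)                 = inj₁ ψ∈Γ
  Stage-mono φ b≡c (inj₂ (inj₁ (ψ<φ , b≡t))) = inj₂ (inj₁ (ψ<φ , trans (sym (b≡c ψ<φ)) b≡t))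
  Stage-mono φ b≡c (inj₂ (inj₂ ψ≡φ))          = inj₂ (inj₂ ψ≡φ)

  -- Unfolding the well-founded recursion requires a step that respects pointwise equality, as
  -- function extensionality is not assumed.
  step-ext : (φ : Formula P) {b c : ∀ {ψ} → ψ < φ → Bool} →
             (∀ {ψ} (ψ<φ : ψ < φ) → b ψ<φ ≡ c ψ<φ) → step φ b ≡ step φ c
  step-ext φ b≡c = does-⇔
    (mk⇔ (_∘ ⊩-mono (Stage-mono φ (λ ψ<φ → sym (b≡c ψ<φ)))) (_∘ ⊩-mono (Stage-mono φ b≡c)))
    em em

  -- φ is chosen iff it is consistent with Γ and the formulas chosen before it.
  chosen : Formula P → Bool
  chosen = All.wfRec wf 0ℓ (λ _ → Bool) step

  UpTo : Formula P → Pred (Formula P) ℓ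
  UpTo φ = Stage φ (λ {ψ} _ → chosen ψ)

  chosen-reflects : ∀ φ → Reflects (Consistent (UpTo φ)) (chosen φ)
  chosen-reflects φ = subst (Reflects _)
    (sym (FixPoint.unfold-wfRec wf (λ _ → Bool) step step-ext)) (proof em)

  -- Γ is joined in by hand: that its members are chosen follows only later, from `limit-closed`.
  Limit : Pred (Formula P) ℓ
  Limit = Γ ∪ Members chosen

  UpTo⊆Limit : UpTo φ ⊆ Limit ∪ ｛ φ ｝
  UpTo⊆Limit (inj₁ ψ∈Γ)              = inj₁ (inj₁ ψ∈Γ)
  UpTo⊆Limit (inj₂ (inj₁ (_ , c)))   = inj₁ (inj₂ c)
  UpTo⊆Limit (inj₂ (inj₂ ψ≡φ))       = inj₂ ψ≡φ

  -- That φ is chosen is what carries φ itself, the candidate of its own stage, over to the later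
  -- stage.
  UpTo-mono : φ < ψ → chosen φ ≡ true → UpTo φ ⊆ UpTo ψ
  UpTo-mono φ<ψ c (inj₁ χ∈Γ)               = inj₁ χ∈Γ
  UpTo-mono φ<ψ c (inj₂ (inj₁ (χ<φ , d)))  = inj₂ (inj₁ (<-trans χ<φ φ<ψ , d))
  UpTo-mono φ<ψ c (inj₂ (inj₂ refl))       = inj₂ (inj₁ (φ<ψ , c))

  -- The witness is the greatest chosen formula among the premises used.
  compact : Limit ⊩ φ → Γ ⊩ φ ⊎ ∃ λ χ → chosen χ ≡ true × (UpTo χ ⊩ φ)
  compact (theorem d)    = inj₁ (theorem d)
  compact (hyp (inj₁ i)) = inj₁ (hyp i)
  compact (hyp (inj₂ c)) = inj₂ (_ , c , hyp (inj₂ (inj₂ refl)))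
  compact (d · e) with compact d | compact e
  ... | inj₁ d′            | inj₁ e′            = inj₁ (d′ · e′)
  ... | inj₁ d′            | inj₂ (χ , c , e′)  = inj₂ (χ , c , ⊩-mono inj₁ d′ · e′)
  ... | inj₂ (χ , c , d′)  | inj₁ e′            = inj₂ (χ , c , d′ · ⊩-mono inj₁ e′)
  ... | inj₂ (χ , c , d′)  | inj₂ (χ′ , c′ , e′) with compare χ χ′
  ...   | tri< χ<χ′ _ _    = inj₂ (χ′ , c′ , ⊩-mono (UpTo-mono χ<χ′ c) d′ · e′)
  ...   | tri≈ _ refl _    = inj₂ (χ , c , d′ · e′)
  ...   | tri> _ _ χ′<χ    = inj₂ (χ , c , d′ · ⊩-mono (UpTo-mono χ′<χ c′) e′)

  -- By compactness an inconsistency already shows in Γ or in `UpTo χ` for a chosen χ, and χ was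
  -- chosen because `UpTo χ` is consistent.
  limit-consistent : Consistent Limit
  limit-consistent d with compact d
  ... | inj₁ d′           = consistent d′
  ... | inj₂ (χ , c , d′) with chosen χ | chosen-reflects χ
  ...   | true | ofʸ con = con d′

  -- A rejected φ makes `UpTo φ` inconsistent, hence also `Limit` with φ added, and `refute`
  -- applies.
  rejected : chosen φ ≡ false → Limit ⊩ ∼ φ
  rejected {φ} c with chosen φ | chosen-reflects φ
  ... | false | ofⁿ ¬con = refute (⊩-mono UpTo⊆Limit (decidable-stable em ¬con))

  limit-closed : Limit ⊩ φ → chosen φ ≡ true
  limit-closed {φ} d with chosen φ in c
  ... | true  = refl
  ... | false = consistent⇒¬both limit-consistent d (rejected c)

  chosen-complement : ∀ φ → chosen (∼ φ) ≡ not (chosen φ)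
  chosen-complement φ with chosen φ in c
  ... | false = limit-closed (rejected c)
  ... | true with chosen (∼ φ) in c′
  ...   | false = refl
  ...   | true  = consistent⇒¬both limit-consistent (hyp (inj₂ c)) (hyp (inj₂ c′))

  world : World P
  world = record
    { val        = chosen
    ; closed     = λ d → limit-closed (⊩-mono inj₂ d)
    ; complement = chosen-complement
    }

  extends : φ ∈ Γ → world ∋ φ
  extends φ∈Γ = limit-closed (hyp (inj₁ φ∈Γ))

lindenbaum : ExcludedMiddle ℓ → WellOrdering ℓ → {P : Set ℓ} (Γ : Pred (Formula P) ℓ) →
             Consistent Γ → ∃ λ (w : World P) → ∀ {φ} → φ ∈ Γ → w ∋ φ
lindenbaum em wo {P} Γ con with wo (Formula P)
... | _<_ , sto , wf = L.world , L.extends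
  where module L = Lindenbaum em _<_ sto wf Γ con

-- The canonical model

_↝_ : {P : Set ℓ} → World P → World P → Set ℓ
s ↝ t = ∀ φ → s ∋ ▲ φ → s ∋ φ → t ∋ φ

↝-refl : Reflexive (_↝_ {P = P})
↝-refl _ _ φ∈s = φ∈s

↝-sym : Symmetric (_↝_ {P = P})
↝-sym {x = s} {y = t} s↝t φ ▲φ∈t φ∈t with val s φ in e
... | true  = refl
... | false = trans (sym (∼-∉ t φ∈t)) ∼φ∈t
  where
  ∼φ∈s : s ∋ ∼ φ
  ∼φ∈s = ∼-∈ s e
  ∼φ∈t : t ∋ ∼ φ
  ∼φ∈t = closed t (hyp (s↝t _ (world-mp s (⊢-▲B (∼ φ)) ∼φ∈s) (world-mp s (⊢-K _ _) ∼φ∈s))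
                   · hyp (▲∼-∈ t ▲φ∈t))

-- `w ↝ t` says exactly that t contains this set; `Lift` brings it to the level at which
-- `lindenbaum` takes its set.
Known : {P : Set ℓ} → World P → Pred (Formula P) ℓ
Known {ℓ} w φ = Lift ℓ (w ∋ ▲ φ × w ∋ φ)

-- Theorems are known by necessitation. For modus ponens, ▲ distributes over the known pair φ ⇒ ψ
-- and φ, and rule R along `⊢-eval` leads to ▲ ψ. R also asks for the truth of the pair, which is
-- why `Known` records φ besides ▲ φ.
known-closed : (w : World P) → Known w ⊩ φ → φ ∈ Known w
known-closed w (theorem d) =
  lift (closed w (theorem (⊢-▲-necessitation d)) , closed w (theorem d))
known-closed w (hyp φ∈K)   = φ∈K
known-closed w (_·_ {φ} {ψ} d e) with known-closed w d | known-closed w e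
... | lift (▲i , i) | lift (▲φ , φ∈w) = lift
  ( closed w (theorem (⊢-rule-R (⊢-eval φ ψ)) ·
      (theorem (⊢-pair _ _) ·
        (theorem (⊢-▲∧ _ _) · (theorem (⊢-pair _ _) · hyp ▲i · hyp ▲φ)) ·
        (theorem (⊢-pair _ _) · hyp i · hyp φ∈w)))
  , closed w (hyp i · hyp φ∈w))

canonical : {P : Set ℓ} → World P → Model P
canonical {ℓ} {P} w = record
  { frame = record { S = World P ; nonempty = w ; R = _↝_ }
  ; V     = λ p s → Lift ℓ (s ∋ var p)
  }

-- Existence lemma: every world that extends `Known s` is a successor of s, so it suffices to extend
-- `Known s` with φ added.
successor : ExcludedMiddle ℓ → WellOrdering ℓ → {P : Set ℓ} {φ : Formula P} (s : World P) →
            ¬ (Known s ⊩ ∼ φ) → ∃ λ t → (s ↝ t) × t ∋ φ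
successor em wo {φ = φ} s ¬d with lindenbaum em wo (Known s ∪ ｛ φ ｝) (¬d ∘ refute)
... | t , extends = t , (λ _ ▲ψ ψ∈s → extends (inj₁ (lift (▲ψ , ψ∈s)))) , extends (inj₂ refl)

-- The truth lemma

reflects⇒ : {A : Set a} {x : Bool} → Reflects A x → A → x ≡ true
reflects⇒ (ofʸ _)  _ = refl
reflects⇒ (ofⁿ ¬a) x = contradiction x ¬a

⇒reflects : {A : Set a} {x : Bool} → Reflects A x → x ≡ true → A
⇒reflects (ofʸ x) _ = x

∼-reflects : {A : Set a} (w : World P) (φ : Formula P) →
             Reflects A (val w φ) → Reflects (¬ A) (val w (∼ φ))
∼-reflects w φ r = subst (Reflects _) (sym (complement w φ)) (¬-reflects r)

-- `Reflects` supplies truth and falsity of φ together, and the clause for ▲ φ refers to both.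
truth : ExcludedMiddle ℓ → WellOrdering ℓ → {P : Set ℓ} (w : World P) (φ : Formula P)
        (s : World P) → Reflects (canonical w , s ⊨ φ) (val s φ)
truth em wo w ⊤       s = subst (Reflects _) (sym (val-⊤ s)) (ofʸ _)
truth em wo w (var p) s =
  fromEquivalence (lift ∘ Equivalence.to T-≡) (Equivalence.from T-≡ ∘ lower)
truth em wo w (∼ φ)   s = ∼-reflects s φ (truth em wo w φ s)
truth em wo w (φ ∧ ψ) s =
  subst (Reflects _) (sym (val-∧ s φ ψ)) (truth em wo w φ s ×-reflects truth em wo w ψ s)
truth em wo w (▲ φ)   s =
  fromEquivalence (⇐ ∘ Equivalence.to T-≡) (Equivalence.from T-≡ ∘ ⇒)
  where
  ih : ∀ t → Reflects (canonical w , t ⊨ φ) (val t φ)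
  ih = truth em wo w φ

  ⇐ : s ∋ ▲ φ → canonical w , s ⊨ ▲ φ
  ⇐ ▲φ∈s =
      (λ s⊨φ t s↝t → ⇒reflects (ih t) (s↝t φ ▲φ∈s (reflects⇒ (ih s) s⊨φ)))
    -- Falsity of φ persists as truth of ∼ φ, since ▲ φ yields ▲ ∼ φ.
    , (λ s⊭φ t s↝t t⊨φ → ∋∼⇒¬∋ t
        (s↝t (∼ φ) (▲∼-∈ s ▲φ∈s) (reflects⇒ (∼-reflects s φ (ih s)) s⊭φ))
        (reflects⇒ (ih t) t⊨φ))

  ⇒ : canonical w , s ⊨ ▲ φ → s ∋ ▲ φ
  -- If ▲ φ is not in s, some successor disagrees with s about φ, against the half of the hypothesis
  -- that fits the value of φ at s.
  ⇒ (stays-true , stays-false) with val s (▲ φ) in ▲φ∉s | val s φ in e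
  ... | true  | _     = refl
  ... | false | true  = contradiction
      (reflects⇒ (ih t) (stays-true (⇒reflects (ih s) e) t s↝t)) (∋∼⇒¬∋ t ∼φ∈t)
    where
    unknown : ¬ (Known s ⊩ ∼ (∼ φ))
    -- Otherwise φ itself would be known, putting ▲ φ into s.
    unknown d with known-closed s (theorem (⊢-double-negation φ) · d)
    ... | lift (▲φ∈s , _) = contradiction (trans (sym ▲φ∉s) ▲φ∈s) λ ()
    next = successor em wo s unknown
    t    = proj₁ next
    s↝t : s ↝ t
    s↝t  = proj₁ (proj₂ next)
    ∼φ∈t = proj₂ (proj₂ next)
  ... | false | false = contradiction (⇒reflects (ih t) φ∈t)
      (stays-false (⇒reflects (∼-reflects s φ (ih s)) (∼-∈ s e)) t s↝t)
    where
    unknown : ¬ (Known s ⊩ ∼ φ)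
    -- Otherwise ∼ φ would be known, and `▲-∈` turns ▲ ∼ φ into ▲ φ.
    unknown d with known-closed s d
    ... | lift (▲∼φ∈s , _) = contradiction (trans (sym ▲φ∉s) (▲-∈ s ▲∼φ∈s)) λ ()
    next = successor em wo s unknown
    t    = proj₁ next
    s↝t : s ↝ t
    s↝t  = proj₁ (proj₂ next)
    φ∈t  = proj₂ (proj₂ next)

-- Strong completeness

𝒯ℬ-complete : ExcludedMiddle ℓ → WellOrdering ℓ → (P : Set ℓ) →
              StronglyComplete P 𝐊𝐁▲ 𝒯ℬ-frames
𝒯ℬ-complete em wo P Γ φ entails = ⊩⇒⊢ (decidable-stable em λ ¬d →
  -- If φ is not derivable, Γ with ∼ φ added is consistent, and a world containing it satisfies it
  -- in the canonical model.
  let w , extends = lindenbaum em wo (Γ ∪ ｛ ∼ φ ｝) λ d →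
        ¬d (theorem (⊢-double-negation φ) · refute d)
  in entails (canonical w) ((λ {s} → ↝-refl {x = s}) , λ {s} {t} → ↝-sym {x = s} {y = t}) w
       λ ψ ψ∈Γ → ⇒reflects (truth em wo w ψ w) (extends ψ∈Γ))

-- Soundness

⇒-intro : (M : Model P) {s : Model.S M} (φ ψ : Formula P) →
          (M , s ⊨ φ → M , s ⊨ ψ) → M , s ⊨ φ ⇒ ψ
⇒-intro M φ ψ f (s⊨φ , s⊭ψ) = s⊭ψ (f s⊨φ)

-- As φ ⇒ ψ abbreviates ∼ (φ ∧ ∼ ψ), it only gives the double negation of ψ directly; excluded
-- middle removes it.
⇒-elim : ExcludedMiddle ℓ → {P : Set ℓ} (M : Model P) {s : Model.S M} (φ ψ : Formula P) →
         M , s ⊨ φ ⇒ ψ → M , s ⊨ φ → M , s ⊨ ψ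
⇒-elim em M φ ψ s⊨φ⇒ψ s⊨φ = decidable-stable em λ s⊭ψ → s⊨φ⇒ψ (s⊨φ , s⊭ψ)

eval-reflects : {P : Set ℓ} (M : Model P) (s : Model.S M) (σ : ℕ → Formula P)
                (v : ℕ → Bool) → (∀ x → Reflects (M , s ⊨ σ x) (v x)) →
                {α : Formula ℕ} (a : Propositional α) → Reflects (M , s ⊨ α [ σ ]) (eval a v)
eval-reflects M s σ v r ⊤       = ofʸ _
eval-reflects M s σ v r (var x) = r x
eval-reflects M s σ v r (∼ a)   = ¬-reflects (eval-reflects M s σ v r a)
eval-reflects M s σ v r (a ∧ b) = eval-reflects M s σ v r a ×-reflects eval-reflects M s σ v r b

axiom-sound : ExcludedMiddle ℓ → {P : Set ℓ} (M : Model P) → Symmetric (Model.R M) →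
              {α : Formula ℕ} → α ∈ 𝐊𝐁▲ → (σ : ℕ → Formula P) (s : Model.S M) → M , s ⊨ α [ σ ]
axiom-sound em M R-sym (inj₁ (taut (a , valid))) σ s =
  ⇒reflects (eval-reflects M s σ (λ x → does (em {M , s ⊨ σ x})) (λ x → proof em) a) (valid _)
axiom-sound em M R-sym (inj₁ ▲⊤) σ s = (λ _ _ _ → _) , (λ s⊭⊤ → contradiction _ s⊭⊤)
axiom-sound em M R-sym (inj₁ ▲∼) σ s =
    ⇒-intro M (▲ (∼ σ 0)) (▲ σ 0) (λ (f , g) →
      (λ x t sRt → decidable-stable em (g (λ ¬x → ¬x x) t sRt)) , f)
  , ⇒-intro M (▲ σ 0) (▲ (∼ σ 0)) (λ (f , g) →
      g , (λ ¬¬x t sRt ¬y → ¬y (f (decidable-stable em ¬¬x) t sRt)))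
axiom-sound em M R-sym (inj₁ ▲∧) σ s =
  ⇒-intro M (▲ σ 0 ∧ ▲ σ 1) (▲ (σ 0 ∧ σ 1)) λ ((f , g) , (f′ , g′)) →
    (λ (x , y) t sRt → f x t sRt , f′ y t sRt) ,
    (λ ¬xy t sRt (x′ , y′) → g (λ x → g′ (λ y → ¬xy (x , y)) t sRt y′) t sRt x′)
axiom-sound em M R-sym (inj₂ refl) σ s =
  -- If p failed at a successor t where ▲ p holds, symmetry would make p fail back at s. The second
  -- half is vacuous, as ▲ p ⇒ p holds at s.
  ⇒-intro M (σ 0) (▲ (▲ σ 0 ⇒ σ 0)) λ x →
    (λ _ t sRt → ⇒-intro M (▲ σ 0) (σ 0) λ (f , g) →
      decidable-stable em λ ¬y → g ¬y s (R-sym sRt) x) ,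
    (λ ¬i → contradiction (⇒-intro M (▲ σ 0) (σ 0) (λ _ → x)) ¬i)

-- All formulas of the sequence are treated at once, as rules cite earlier ones by membership, and
-- at all points, as rule R uses its premise at successors too.
derivation-sound : ExcludedMiddle ℓ → {P : Set ℓ} (M : Model P) → Symmetric (Model.R M) →
                   {xs : List (Formula P)} → Derivation 𝐊𝐁▲ ∅ xs →
                   All (λ φ → ∀ s → M , s ⊨ φ) xs
derivation-sound em M R-sym []       = []
derivation-sound em M R-sym (j ∷ ds) = justified j ∷ valid
  where
  valid = derivation-sound em M R-sym ds
  justified : ∀ {φ} → Justified 𝐊𝐁▲ ∅ _ φ → ∀ s → M , s ⊨ φ
  justified (axiom α∈Ax σ)         s = axiom-sound em M R-sym α∈Ax σ s
  justified (mp {φ} {ψ} i j)       s =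
    ⇒-elim em M φ ψ (All.lookup valid i s) (All.lookup valid j s)
  justified (rule-R {φ} {ψ} i)     s =
    ⇒-intro M (▲ φ ∧ φ) (▲ ψ) λ ((f , g) , x) →
      (λ _ t sRt → φ⇒ψ t (f x t sRt)) , (λ ¬y → contradiction (φ⇒ψ s x) ¬y)
    where
    φ⇒ψ : ∀ t → M , t ⊨ φ → M , t ⊨ ψ
    φ⇒ψ t = ⇒-elim em M φ ψ (All.lookup valid i t)

ℬ-sound : ExcludedMiddle ℓ → (P : Set ℓ) → Sound P 𝐊𝐁▲ ℬ-frames
ℬ-sound em P φ (_ , d) F R-sym V =
  All.head (derivation-sound em (record { frame = F ; V = V }) R-sym d)

theorem55 : ∀ {ℓ : Level} → ExcludedMiddle ℓ → WellOrdering ℓ → (P : Set ℓ) →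
    (Sound P 𝐊𝐁▲ ℬ-frames × StronglyComplete P 𝐊𝐁▲ ℬ-frames) ×
    (Sound P 𝐊𝐁▲ 𝒯ℬ-frames × StronglyComplete P 𝐊𝐁▲ 𝒯ℬ-frames)
theorem55 em wo P =
    -- Entailment over all symmetric frames restricts to the reflexive ones, so completeness passes
    -- to the larger class and soundness to the smaller.
    (ℬ-sound em P , λ Γ φ entails →
      𝒯ℬ-complete em wo P Γ φ λ M (_ , R-sym) → entails M R-sym)
  , ((λ φ d F (_ , R-sym) → ℬ-sound em P φ d F R-sym) , 𝒯ℬ-complete em wo P)
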